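{- Let $E$ be a finite set of equations. If there exists a run of MMA on $E$ in which action (6) is not performed, then MMA$^-$ is sound for $E$: every run of MMA$^-$ on $E$ halts with failure if $E$ is not unifiable, and otherwise produces a unifiable equation set $E'$ in semi-solved form (so that iteratively applying action (5) of MMA to $E'$ yields an equation set in solved form representing an mgu of $E$).
   Context: MMA (Martelli–Montanari algorithm) operates on a finite set of equations by nondeterministically choosing an equation and applying one of: (1) $f(s_1,\ldots,s_n)\doteq f(t_1,\ldots,t_n)$: replace by $s_1\doteq t_1,\ldots,s_n\doteq t_n$; (2) $f(\ldots)\doteq g(\ldots)$ with $f\neq g$: halt with failure; (3) $X\doteq X$: delete; (4) $t\doteq X$ with $t$ not a variable: replace by $X\doteq t$; (5) $X\doteq t$ with $X\notin Var(t)$ and $X$ occurring elsewhere: apply $\{X/t\}$ to all other equations; (6) $X\doteq t$ with $X\in Var(t)$ and $X\neq t$: halt with failure. A run is a maximal sequence of equation sets each obtained from the previous by one action. MMA$^-$ has actions (1)–(4) of MMA and, instead of (5) and (6): (5a) $X\doteq Y$ with $X,Y$ distinct variables and $X$ occurring elsewhere: apply $\{X/Y\}$ to all other equations; (5b) two equations $X\doteq t$, $X\doteq u$ with $t,u$ distinct non-variable terms: letting $\{s_1,s_2\}=\{t,u\}$ with $|s_1|\le|s_2|$ ($|\cdot|$ = number of occurrences of variables and function symbols), replace $X\doteq s_2$ by $s_1\doteq s_2$. A set is in semi-solved form if it is $\{X_1\doteq t_1,\ldots,X_n\doteq t_n\}$ with distinct variables $X_i$, each $X_i\neq t_i$, and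 $X_i$ occurring only once in the set whenever $t_i$ is a variable; it is in solved form if moreover no $X_i$ occurs in any $t_j$, and then $\{X_1/t_1,\ldots,X_n/t_n\}$ is the represented mgu. -}

module Defs where

open import Data.Nat using (ℕ; zero; suc; _+_; _≤_; _≟_)
open import Data.Fin using (Fin)
open import Data.Vec using (Vec; []; _∷_; lookup; toList; zip)
open import Data.List using (List; []; _∷_)
open import Data.List.Membership.Propositional using (_∈_)
open import Data.Maybe using (Maybe; just; nothing)
open import Data.Product using (_×_; _,_; ∃; ∃₂)
open import Data.Sum using (_⊎_)
open import Data.Unit using (⊤)
open import Relation.Nullary using (¬_; yes; no)
open import Relation.Binary.PropositionalEquality using (_≡_; _≢_)
open import Function.Bundles using (_⇔_)

record Signature : Set₁ where
  field
    F  : Set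
    ar : F → ℕ

open Signature public

module _ (S : Signature) where

  data Term : Set where
    var : ℕ → Term
    fn  : (f : F S) → Vec Term (ar S f) → Term

  Subst : Set
  Subst = ℕ → Term

  mutual
    _⟨_⟩ : Term → Subst → Term
    var x   ⟨ σ ⟩ = σ x
    fn f ts ⟨ σ ⟩ = fn f (substVec ts σ)

    substVec : ∀ {n} → Vec Term n → Subst → Vec Term n
    substVec []       σ = []
    substVec (t ∷ ts) σ = (t ⟨ σ ⟩) ∷ substVec ts σ

  mutual
    size : Term → ℕ
    size (var x)   = 1
    size (fn f ts) = suc (sizeVec ts)

    sizeVec : ∀ {n} → Vec Term n → ℕ
    sizeVec []       = 0
    sizeVec (t ∷ ts) = size t + sizeVec ts

  data _occ_ (x : ℕ) : Term → Set where
    here  : x occ var x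
    inArg : ∀ {f ts} (i : Fin (ar S f)) → x occ lookup ts i → x occ fn f ts

  Eqn : Set
  Eqn = Term × Term

  _≐_ : Term → Term → Eqn
  s ≐ t = s , t

  OccEq : ℕ → Eqn → Set
  OccEq x (s , t) = x occ s ⊎ x occ t

  _⟨_⟩ₑ : Eqn → Subst → Eqn
  (s , t) ⟨ σ ⟩ₑ = (s ⟨ σ ⟩) , (t ⟨ σ ⟩)

  _↦_ : ℕ → Term → Subst
  (x ↦ t) y with y ≟ x
  ... | yes _ = t
  ... | no  _ = var y

  -- Finite equation sets are lists read as sets (only membership matters).
  -- E' is obtained from E by replacing the equation e ∈ E by the equations N.
  Replace : List Eqn → Eqn → List Eqn → List Eqn → Set
  Replace E e N E' = e ∈ E × (∀ d → (d ∈ E' ⇔ ((d ∈ E × d ≢ e) ⊎ d ∈ N)))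

  OccElsewhere : ℕ → Eqn → List Eqn → Set
  OccElsewhere x e E = ∃ λ d → d ∈ E × d ≢ e × OccEq x d

  ApplyElsewhere : List Eqn → ℕ → Term → List Eqn → Set
  ApplyElsewhere E x t E' =
    ∀ d → (d ∈ E' ⇔ (d ≡ (var x ≐ t)
                     ⊎ ∃ λ d₀ → d₀ ∈ E × d₀ ≢ (var x ≐ t) × d ≡ (d₀ ⟨ x ↦ t ⟩ₑ)))

  data Config : Set where
    ok   : List Eqn → Config
    fail : Config

  data Act : Set where
    a1 a2 a3 a4 a5 a6 : Act

  data MMA : Act → Config → Config → Set where
    act1 : ∀ {E E'} f (ss ts : Vec Term (ar S f)) →
           Replace E (fn f ss ≐ fn f ts) (toList (zip ss ts)) E' →
           MMA a1 (ok E) (ok E')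
    act2 : ∀ {E} f g (ss : Vec Term (ar S f)) (ts : Vec Term (ar S g)) →
           (fn f ss ≐ fn g ts) ∈ E → f ≢ g →
           MMA a2 (ok E) fail
    act3 : ∀ {E E'} x →
           Replace E (var x ≐ var x) [] E' →
           MMA a3 (ok E) (ok E')
    act4 : ∀ {E E'} x f (ts : Vec Term (ar S f)) →
           Replace E (fn f ts ≐ var x) ((var x ≐ fn f ts) ∷ []) E' →
           MMA a4 (ok E) (ok E')
    act5 : ∀ {E E'} x t →
           (var x ≐ t) ∈ E → ¬ (x occ t) → OccElsewhere x (var x ≐ t) E →
           ApplyElsewhere E x t E' →
           MMA a5 (ok E) (ok E')
    act6 : ∀ {E} x t →
           (var x ≐ t) ∈ E → x occ t → var x ≢ t →
           MMA a6 (ok E) fail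

  data Act⁻ : Set where
    b1 b2 b3 b4 b5a b5b : Act⁻

  data MMA⁻ : Act⁻ → Config → Config → Set where
    act1 : ∀ {E E'} f (ss ts : Vec Term (ar S f)) →
           Replace E (fn f ss ≐ fn f ts) (toList (zip ss ts)) E' →
           MMA⁻ b1 (ok E) (ok E')
    act2 : ∀ {E} f g (ss : Vec Term (ar S f)) (ts : Vec Term (ar S g)) →
           (fn f ss ≐ fn g ts) ∈ E → f ≢ g →
           MMA⁻ b2 (ok E) fail
    act3 : ∀ {E E'} x →
           Replace E (var x ≐ var x) [] E' →
           MMA⁻ b3 (ok E) (ok E')
    act4 : ∀ {E E'} x f (ts : Vec Term (ar S f)) →
           Replace E (fn f ts ≐ var x) ((var x ≐ fn f ts) ∷ []) E' →
           MMA⁻ b4 (ok E) (ok E')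
    act5a : ∀ {E E'} x y →
           (var x ≐ var y) ∈ E → x ≢ y → OccElsewhere x (var x ≐ var y) E →
           ApplyElsewhere E x (var y) E' →
           MMA⁻ b5a (ok E) (ok E')
    act5b : ∀ {E E'} x f g (ss : Vec Term (ar S f)) (ts : Vec Term (ar S g)) →
           (var x ≐ fn f ss) ∈ E → (var x ≐ fn g ts) ∈ E →
           fn f ss ≢ fn g ts →
           size (fn f ss) ≤ size (fn g ts) →
           Replace E (var x ≐ fn g ts) ((fn f ss ≐ fn g ts) ∷ []) E' →
           MMA⁻ b5b (ok E) (ok E')

  MMA5 : ⊤ → Config → Config → Set
  MMA5 _ = MMA a5

  Unifier : Subst → List Eqn → Set
  Unifier σ E = ∀ s t → (s ≐ t) ∈ E → (s ⟨ σ ⟩) ≡ (t ⟨ σ ⟩)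

  Unifiable : List Eqn → Set
  Unifiable E = ∃ λ σ → Unifier σ E

  MGU : Subst → List Eqn → Set
  MGU θ E = Unifier θ E ×
            (∀ σ → Unifier σ E → ∃ λ δ → ∀ x → σ x ≡ (θ x ⟨ δ ⟩))

  SemiSolved : List Eqn → Set
  SemiSolved E =
    (∀ e → e ∈ E → ∃₂ λ x t → e ≡ (var x ≐ t) × t ≢ var x) ×
    (∀ x t u → (var x ≐ t) ∈ E → (var x ≐ u) ∈ E → t ≡ u) ×
    (∀ x y → (var x ≐ var y) ∈ E →
       ∀ d → d ∈ E → d ≢ (var x ≐ var y) → ¬ OccEq x d)

  Solved : List Eqn → Set
  Solved E = SemiSolved E ×
    (∀ x t y u → (var x ≐ t) ∈ E → (var y ≐ u) ∈ E → ¬ (x occ u))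

  repr : List Eqn → Subst
  repr []                   x = var x
  repr ((var y , t) ∷ E)    x with x ≟ y
  ... | yes _ = t
  ... | no  _ = repr E x
  repr ((fn f ts , t) ∷ E)  x = repr E x

-- Runs of a labelled (nondeterministic) transition system: maximal sequences,
-- finite (conf becomes nothing after the last configuration) or infinite.
module _ {S : Signature} where

  Terminal : {L : Set} → (L → Config S → Config S → Set) → Config S → Set
  Terminal Step c = ∀ a c' → ¬ Step a c c'

  record Run {L : Set} (Step : L → Config S → Config S → Set) (c₀ : Config S) : Set where
    field
      conf  : ℕ → Maybe (Config S)
      lab   : ℕ → L
      start : conf 0 ≡ just c₀
      next  : ∀ n c → conf n ≡ just c →
              (∃ λ c' → conf (suc n) ≡ just c' × Step (lab n) c c')
              ⊎ (conf (suc n) ≡ nothing × Terminal Step c)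
      dead  : ∀ n → conf n ≡ nothing → conf (suc n) ≡ nothing

  open Run public

  HaltsWith : {L : Set} {Step : L → Config S → Config S → Set} {c₀ : Config S} →
              Run Step c₀ → Config S → Set
  HaltsWith r c = ∃ λ n → conf r n ≡ just c × conf r (suc n) ≡ nothing

  No6 : {c₀ : Config S} → Run (MMA S) c₀ → Set
  No6 r = ∀ n c c' → conf r n ≡ just c → conf r (suc n) ≡ just c' → lab r n ≢ a6

{-# OPTIONS --safe #-}
module Submission where

-- Call a relation on terms decomposable if it is a congruence that relates the arguments of
-- related applications and never relates applications of distinct symbols.  Every action other
-- than (6) preserves, in both directions, the property that all equations hold in a given
-- decomposable relation, and (2) is impossible for a set with this property.  Two instances
-- matter: equality under a substitution, which gives the preservation of unifiers, and equality
-- of the possibly infinite trees obtained by unfolding a semi-solved form.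
-- If MMA⁻ ends in a semi-solved form, the latter relation satisfies E, so the given run of MMA
-- cannot fail by (2); as it does not perform (6), it reaches a solved form and E is unifiable.
-- Termination: lexicographically, the number of variables that are not yet eliminated, then a
-- sum over the equations of a potential of the larger side.
-- Function symbols need not have decidable equality.  Hence terminality only yields facts up to
-- double negation; a unifier of E, when there is one, removes the double negations.

open import Defs
open import Data.Nat using (ℕ; zero; suc; _+_; _*_; _⊔_; _≤_; _<_; _≟_; z≤n; s≤s)
open import Data.Nat.Properties
open import Data.Nat.Tactic.RingSolver using (solve-∀)
open import Data.Fin using (Fin; zero; suc)
open import Data.Vec using (Vec; []; _∷_; lookup; toList; zip)
import Data.Vec as Vec
open import Data.Vec.Properties using (lookup-map)
open import Data.List using (List; []; _∷_; _++_; map)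
open import Data.List.Membership.Propositional using (_∈_)
open import Data.List.Membership.Propositional.Properties using (∈-map⁺; ∈-map⁻; ∈-++⁺ˡ; ∈-++⁺ʳ; ∈-++⁻)
open import Data.List.Relation.Unary.Any using (here; there)
open import Data.Maybe using (just)
open import Data.Product using (_×_; _,_; proj₁; proj₂; ∃; ∃₂; Σ)
open import Data.Sum using (_⊎_; inj₁; inj₂; [_,_]′)
open import Data.Empty using (⊥; ⊥-elim)
open import Function using (_∘_; id; flip)
open import Function.Bundles using (_⇔_; mk⇔; Equivalence)
open import Induction.WellFounded using (Acc; acc; WellFounded)
open import Relation.Nullary using (¬_; Dec; yes; no; contradiction)
open import Relation.Nullary.Decidable using (¬¬-excluded-middle; decidable-stable)
open import Relation.Nullary.Negation using (¬¬-map; negated-stable)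
open import Relation.Binary.Construct.Closure.ReflexiveTransitive using (Star; ε; _◅_; _◅◅_)
open import Relation.Binary.PropositionalEquality using (_≡_; _≢_; refl; sym; trans; cong; cong₂; subst)

open Equivalence using (to; from)

-- Double negation over finite domains

¬¬-bind : {A B : Set} → ¬ ¬ A → (A → ¬ ¬ B) → ¬ ¬ B
¬¬-bind a f k = a λ x → f x k

¬¬-∀Fin : ∀ {n} {P : Fin n → Set} → (∀ i → ¬ ¬ P i) → ¬ ¬ (∀ i → P i)
¬¬-∀Fin {zero}  h k = k λ ()
¬¬-∀Fin {suc n} h = ¬¬-bind (h zero) λ p → ¬¬-map (λ ps → λ { zero → p ; (suc i) → ps i }) (¬¬-∀Fin (h ∘ suc))

¬¬-∀∈ : {A : Set} {P : A → Set} (xs : List A) → (∀ x → x ∈ xs → ¬ ¬ P x) → ¬ ¬ (∀ x → x ∈ xs → P x)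
¬¬-∀∈ []       h k = k λ _ ()
¬¬-∀∈ (y ∷ ys) h = ¬¬-bind (h y (here refl)) λ p →
  ¬¬-map (λ ps → λ { x (here refl) → p ; x (there m) → ps x m }) (¬¬-∀∈ ys λ x → h x ∘ there)

-- `P` is later taken to be inequality with a fixed equation, which is not decidable; the filtered
-- list therefore exists only up to double negation.
¬¬-filter : {A : Set} (P : A → Set) (xs : List A) → ¬ ¬ (∃ λ ys → ∀ d → d ∈ ys ⇔ (d ∈ xs × P d))
¬¬-filter P [] k = k ([] , λ d → mk⇔ (λ ()) λ ())
¬¬-filter P (x ∷ xs) = ¬¬-bind (¬¬-filter P xs) λ (ys , eq) → ¬¬-map (extend ys eq) ¬¬-excluded-middle
  where
  extend : ∀ ys → (∀ d → d ∈ ys ⇔ (d ∈ xs × P d)) → Dec (P x) → ∃ λ zs → ∀ d → d ∈ zs ⇔ (d ∈ x ∷ xs × P d)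
  extend ys eq (yes p) = x ∷ ys , λ d → mk⇔
    (λ { (here refl) → here refl , p ; (there m) → there (proj₁ (to (eq d) m)) , proj₂ (to (eq d) m) })
    λ { (here refl , _) → here refl ; (there m , q) → there (from (eq d) (m , q)) }
  extend ys eq (no ¬p) = ys , λ d → mk⇔
    (λ m → there (proj₁ (to (eq d) m)) , proj₂ (to (eq d) m))
    λ { (here refl , q) → contradiction q ¬p ; (there m , q) → from (eq d) (m , q) }

-- Sums over lists

sumOf : {A : Set} → (A → ℕ) → List A → ℕ
sumOf g []       = 0
sumOf g (x ∷ xs) = g x + sumOf g xs

sumOf-++ : {A : Set} (g : A → ℕ) (xs ys : List A) → sumOf g (xs ++ ys) ≡ sumOf g xs + sumOf g ys
sumOf-++ g []       ys = refl
sumOf-++ g (x ∷ xs) ys = trans (cong (g x +_) (sumOf-++ g xs ys)) (sym (+-assoc (g x) _ _))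

sumOf-map-≤ : {A : Set} (g : A → ℕ) (h : A → A) → (∀ x → g (h x) ≤ g x) → ∀ xs → sumOf g (map h xs) ≤ sumOf g xs
sumOf-map-≤ g h le []       = z≤n
sumOf-map-≤ g h le (x ∷ xs) = +-mono-≤ (le x) (sumOf-map-≤ g h le xs)

sumOf-map-0 : {A : Set} (g : A → ℕ) (h : A → A) → (∀ x → g (h x) ≡ 0) → ∀ xs → sumOf g (map h xs) ≡ 0
sumOf-map-0 g h eq []       = refl
sumOf-map-0 g h eq (x ∷ xs) = cong₂ _+_ (eq x) (sumOf-map-0 g h eq xs)

∈⇒≤sumOf : {A : Set} (g : A → ℕ) {x : A} {xs : List A} → x ∈ xs → g x ≤ sumOf g xs
∈⇒≤sumOf g (here refl) = m≤m+n _ _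
∈⇒≤sumOf g (there m)   = ≤-trans (∈⇒≤sumOf g m) (m≤n+m _ _)

-- `rest` drops a single occurrence of `x`, so that sums split exactly. Further copies of `x` may
-- remain in it, and `∈-rest` tolerates them.
record Split {A : Set} (x : A) (xs : List A) : Set where
  field
    rest     : List A
    sum-rest : ∀ g → sumOf g xs ≡ g x + sumOf g rest
    ∈-rest   : ∀ {d} → d ∈ xs → d ≢ x → d ∈ rest

split : {A : Set} {x : A} {xs : List A} → x ∈ xs → Split x xs
split {xs = x ∷ xs} (here refl) = record
  { rest = xs ; sum-rest = λ g → refl
  ; ∈-rest = λ { (here refl) ne → contradiction refl ne ; (there m) _ → m } }
split {x = x} {y ∷ ys} (there m) = record
  { rest = y ∷ rest
  ; sum-rest = λ g → trans (cong (g y +_) (sum-rest g)) (swap (g y) (g x) _)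
  ; ∈-rest = λ { (here refl) _ → here refl ; (there p) ne → there (∈-rest p ne) } }
  where
  open Split (split m)
  swap : ∀ a b c → a + (b + c) ≡ b + (a + c)
  swap = solve-∀

-- Counting the variables of weight at least 2

over : ℕ → ℕ
over 0             = 0
over 1             = 0
over (suc (suc _)) = 1

over-mono : ∀ m n → (m ≤ 1 → n ≤ 1) → over n ≤ over m
over-mono 0 n h with h z≤n
... | z≤n     = z≤n
... | s≤s z≤n = z≤n
over-mono 1 n h with h (s≤s z≤n)
... | z≤n     = z≤n
... | s≤s z≤n = z≤n
over-mono (suc (suc m)) 0             h = z≤n
over-mono (suc (suc m)) 1             h = z≤n
over-mono (suc (suc m)) (suc (suc n)) h = s≤s z≤n

over-strict : ∀ {m n} → 2 ≤ m → n ≤ 1 → over n < over m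
over-strict (s≤s (s≤s _)) z≤n       = s≤s z≤n
over-strict (s≤s (s≤s _)) (s≤s z≤n) = s≤s z≤n

countOver : (ℕ → ℕ) → ℕ → ℕ
countOver w zero    = 0
countOver w (suc n) = over (w n) + countOver w n

countOver-mono : ∀ w w' → (∀ z → w z ≤ 1 → w' z ≤ 1) → ∀ n → countOver w' n ≤ countOver w n
countOver-mono w w' h zero    = z≤n
countOver-mono w w' h (suc n) = +-mono-≤ (over-mono (w n) (w' n) (h n)) (countOver-mono w w' h n)

countOver-strict : ∀ w w' → (∀ z → w z ≤ 1 → w' z ≤ 1) → ∀ {x} → 2 ≤ w x → w' x ≤ 1 →
                   ∀ n → x < n → countOver w' n < countOver w n
countOver-strict w w' h {x} big small (suc n) x<1+n with x ≟ n
... | yes refl = +-mono-<-≤ (over-strict big small) (countOver-mono w w' h n)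
... | no  x≢n  = +-mono-≤-< (over-mono (w n) (w' n) (h n))
                   (countOver-strict w w' h big small n (≤∧≢⇒< (≤-pred x<1+n) x≢n))

-- Superadditive, so it dominates the sum over the arguments of a term, and growing
-- fast enough to absorb the two sides of an equation and the orientation rank.
pot : ℕ → ℕ
pot zero    = 0
pot (suc n) = 4 * pot n + 1

pot-+ : ∀ m n → pot m + pot n ≤ pot (m + n)
pot-+ zero    n = ≤-refl
pot-+ (suc m) n = begin
  4 * pot m + 1 + pot n        ≤⟨ m≤m+n _ (3 * pot n) ⟩
  4 * pot m + 1 + pot n + 3 * pot n ≡⟨ lemma (pot m) (pot n) ⟩
  4 * (pot m + pot n) + 1      ≤⟨ +-monoˡ-≤ 1 (*-monoʳ-≤ 4 (pot-+ m n)) ⟩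
  4 * pot (m + n) + 1          ∎
  where
  open ≤-Reasoning
  lemma : ∀ a b → 4 * a + 1 + b + 3 * b ≡ 4 * (a + b) + 1
  lemma = solve-∀

pot-⊔ : ∀ m n → pot (m ⊔ n) ≤ pot m + pot n
pot-⊔ m n with ⊔-sel m n
... | inj₁ eq rewrite eq = m≤m+n _ _
... | inj₂ eq rewrite eq = m≤n+m _ _

pot-mono : ∀ {m n} → m ≤ n → pot m ≤ pot n
pot-mono {m} m≤n with m≤n⇒∃[o]m+o≡n m≤n
... | o , refl = ≤-trans (m≤m+n _ _) (pot-+ m o)

-- Zipped vectors

∈-zip⁻ : {A : Set} {n : ℕ} (xs ys : Vec A n) {d : A × A} → d ∈ toList (zip xs ys) → ∃ λ i → d ≡ (lookup xs i , lookup ys i)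
∈-zip⁻ [] [] ()
∈-zip⁻ (x ∷ xs) (y ∷ ys) (here refl) = zero , refl
∈-zip⁻ (x ∷ xs) (y ∷ ys) (there m) with ∈-zip⁻ xs ys m
... | i , eq = suc i , eq

∈-zip⁺ : {A : Set} {n : ℕ} (xs ys : Vec A n) (i : Fin n) → (lookup xs i , lookup ys i) ∈ toList (zip xs ys)
∈-zip⁺ (x ∷ xs) (y ∷ ys) zero    = here refl
∈-zip⁺ (x ∷ xs) (y ∷ ys) (suc i) = there (∈-zip⁺ xs ys i)

lookup-ext : {A : Set} {n : ℕ} (xs ys : Vec A n) → (∀ i → lookup xs i ≡ lookup ys i) → xs ≡ ys
lookup-ext []       []       h = refl
lookup-ext (x ∷ xs) (y ∷ ys) h = cong₂ _∷_ (h zero) (lookup-ext xs ys (h ∘ suc))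

module _ (S : Signature) where

  private
    T : Set
    T = Term S

    infixl 20 _[_] _[_]ₑ
    _[_] : T → Subst S → T
    _[_] = _⟨_⟩ S

    _[_]ₑ : Eqn S → Subst S → Eqn S
    _[_]ₑ = _⟨_⟩ₑ S

    _:=_ : ℕ → T → Subst S
    _:=_ = _↦_ S

    Occ : ℕ → T → Set
    Occ = _occ_ S

  -- Substitutions

  lookup-substVec : ∀ {n} (ts : Vec T n) σ i → lookup (substVec S ts σ) i ≡ lookup ts i [ σ ]
  lookup-substVec (t ∷ ts) σ zero    = refl
  lookup-substVec (t ∷ ts) σ (suc i) = lookup-substVec ts σ i

  fn-injective : ∀ {f} {ss ts : Vec T (ar S f)} → fn f ss ≡ fn f ts → ss ≡ ts
  fn-injective refl = refl

  fn-injectiveˡ : ∀ {f g} {ss : Vec T (ar S f)} {ts : Vec T (ar S g)} → Term.fn f ss ≡ fn g ts → f ≡ g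
  fn-injectiveˡ refl = refl

  var-injective : ∀ {x y} → _≡_ {A = T} (var x) (var y) → x ≡ y
  var-injective refl = refl

  :=-miss : ∀ {x y} t → y ≢ x → (x := t) y ≡ var y
  :=-miss {x} {y} t y≢x with y ≟ x
  ... | yes eq = contradiction eq y≢x
  ... | no _   = refl

  mutual
    subst-id : ∀ s σ → (∀ z → Occ z s → σ z ≡ var z) → s [ σ ] ≡ s
    subst-id (var x)   σ h = h x here
    subst-id (fn f ts) σ h = cong (fn f) (substVec-id ts σ λ z i → h z ∘ inArg i)

    substVec-id : ∀ {n} (ts : Vec T n) σ → (∀ z i → Occ z (lookup ts i) → σ z ≡ var z) → substVec S ts σ ≡ ts
    substVec-id []       σ h = refl
    substVec-id (t ∷ ts) σ h = cong₂ _∷_ (subst-id t σ λ z → h z zero) (substVec-id ts σ λ z i → h z (suc i))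

  mutual
    subst-absorb : ∀ s θ σ → (∀ x → σ x ≡ θ x [ σ ]) → s [ θ ] [ σ ] ≡ s [ σ ]
    subst-absorb (var x)   θ σ h = sym (h x)
    subst-absorb (fn f ts) θ σ h = cong (fn f) (substVec-absorb ts θ σ h)

    substVec-absorb : ∀ {n} (ts : Vec T n) θ σ → (∀ x → σ x ≡ θ x [ σ ]) → substVec S (substVec S ts θ) σ ≡ substVec S ts σ
    substVec-absorb []       θ σ h = refl
    substVec-absorb (t ∷ ts) θ σ h = cong₂ _∷_ (subst-absorb t θ σ h) (substVec-absorb ts θ σ h)

  -- Equality of function symbols need not be stable under double negation; what makes
  -- equality of u and v stable is a common instance, which supplies the equal symbols.
  mutual
    ≡-stable : ∀ u v δ → u [ δ ] ≡ v [ δ ] → ¬ ¬ (u ≡ v) → u ≡ v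
    ≡-stable (var x)   (var y)   δ eq nn = cong var (decidable-stable (x ≟ y) (¬¬-map var-injective nn))
    ≡-stable (var x)   (fn g vs) δ eq nn = ⊥-elim (nn λ ())
    ≡-stable (fn f us) (var y)   δ eq nn = ⊥-elim (nn λ ())
    ≡-stable (fn f us) (fn g vs) δ eq nn with fn-injectiveˡ eq
    ... | refl = cong (fn f) (≡-stableVec us vs δ (fn-injective eq) (¬¬-map fn-injective nn))

    ≡-stableVec : ∀ {n} (us vs : Vec T n) δ → substVec S us δ ≡ substVec S vs δ → ¬ ¬ (us ≡ vs) → us ≡ vs
    ≡-stableVec []       []       δ eq nn = refl
    ≡-stableVec (u ∷ us) (v ∷ vs) δ eq nn = cong₂ _∷_
      (≡-stable u v δ (cong Vec.head eq) (¬¬-map (cong Vec.head) nn))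
      (≡-stableVec us vs δ (cong Vec.tail eq) (¬¬-map (cong Vec.tail) nn))

  size-pos : ∀ s → 1 ≤ size S s
  size-pos (var x)   = ≤-refl
  size-pos (fn f ts) = s≤s z≤n

  size-lookup : ∀ {n} (ts : Vec T n) i → size S (lookup ts i) ≤ sizeVec S ts
  size-lookup (t ∷ ts) zero    = m≤m+n _ _
  size-lookup (t ∷ ts) (suc i) = ≤-trans (size-lookup ts i) (m≤n+m _ _)

  size-occ : ∀ {x t} σ → Occ x t → size S (σ x) ≤ size S (t [ σ ])
  size-occ σ here = ≤-refl
  size-occ σ (inArg {f} {ts} i o) = ≤-trans (size-occ σ o)
    (m≤n⇒m≤1+n (subst (λ u → size S u ≤ sizeVec S (substVec S ts σ)) (lookup-substVec ts σ i)
      (size-lookup (substVec S ts σ) i)))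

  -- Below a function symbol, an occurrence of `x` in `t` puts `σ x` properly inside `t [ σ ]`, and
  -- the two sizes differ.
  occurs-check : ∀ {x t} σ → t ≢ var x → σ x ≡ t [ σ ] → ¬ Occ x t
  occurs-check σ t≢x eq here = t≢x refl
  occurs-check {x} σ t≢x eq (inArg {f} {ts} i o) = <-irrefl (cong (size S) eq)
    (s≤s (≤-trans (size-occ σ o)
      (subst (λ u → size S u ≤ sizeVec S (substVec S ts σ)) (lookup-substVec ts σ i)
        (size-lookup (substVec S ts σ) i))))

  Occ-:= : ∀ {x t z} s → Occ z (s [ x := t ]) → Occ z s ⊎ Occ z t
  Occ-:= {x} (var y) o with y ≟ x
  ... | yes _ = inj₂ o
  ... | no  _ = inj₁ o
  Occ-:= {x} {t} {z} (fn f ts) (inArg i o) = [ inj₁ ∘ inArg i , inj₂ ]′ (argument ts i o)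
    where
    argument : ∀ {n} (us : Vec T n) j → Occ z (lookup (substVec S us (x := t)) j) → Occ z (lookup us j) ⊎ Occ z t
    argument (u ∷ us) zero    p = Occ-:= u p
    argument (u ∷ us) (suc j) p = argument us j p

  -- A transition relation subsuming MMA⁻ and the actions of MMA other than (6)

  data Simplify : Eqn S → List (Eqn S) → Set where
    decompose : ∀ f (ss ts : Vec T (ar S f)) → Simplify (fn f ss , fn f ts) (toList (zip ss ts))
    delete    : ∀ x → Simplify (var x , var x) []
    orient    : ∀ x f (ts : Vec T (ar S f)) → Simplify (fn f ts , var x) ((var x , fn f ts) ∷ [])

  data _⟶_ : Config S → Config S → Set where
    simplify : ∀ {E E' e N} → Simplify e N → Replace S E e N E' → ok E ⟶ ok E'
    clash    : ∀ {E} f g (ss : Vec T (ar S f)) (ts : Vec T (ar S g)) →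
               (fn f ss , fn g ts) ∈ E → f ≢ g → ok E ⟶ fail
    eliminate : ∀ {E E'} x t → (var x , t) ∈ E → ¬ Occ x t → OccElsewhere S x (var x , t) E →
               ApplyElsewhere S E x t E' → ok E ⟶ ok E'
    merge    : ∀ {E E'} x f g (ss : Vec T (ar S f)) (ts : Vec T (ar S g)) →
               (var x , fn f ss) ∈ E → Term.fn f ss ≢ fn g ts → size S (fn f ss) ≤ size S (fn g ts) →
               Replace S E (var x , fn g ts) ((fn f ss , fn g ts) ∷ []) E' → ok E ⟶ ok E'

  MMA⊆⟶ : ∀ {a c c'} → a ≢ a6 → MMA S a c c' → c ⟶ c'
  MMA⊆⟶ _ (act1 f ss ts r)       = simplify (decompose f ss ts) r
  MMA⊆⟶ _ (act2 f g ss ts m f≢g) = clash f g ss ts m f≢g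
  MMA⊆⟶ _ (act3 x r)             = simplify (delete x) r
  MMA⊆⟶ _ (act4 x f ts r)        = simplify (orient x f ts) r
  MMA⊆⟶ _ (act5 x t m x∉t o a)   = eliminate x t m x∉t o a
  MMA⊆⟶ a≢a6 (act6 _ _ _ _ _)    = contradiction refl a≢a6

  MMA⁻⊆⟶ : ∀ {a c c'} → MMA⁻ S a c c' → c ⟶ c'
  MMA⁻⊆⟶ (act1 f ss ts r)              = simplify (decompose f ss ts) r
  MMA⁻⊆⟶ (act2 f g ss ts m f≢g)        = clash f g ss ts m f≢g
  MMA⁻⊆⟶ (act3 x r)                    = simplify (delete x) r
  MMA⁻⊆⟶ (act4 x f ts r)               = simplify (orient x f ts) r
  MMA⁻⊆⟶ (act5a x y m x≢y o a)         = eliminate x (var y) m (λ { here → x≢y refl }) o a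
  MMA⁻⊆⟶ (act5b x f g ss ts m _ ne le r) = merge x f g ss ts m ne le r

  -- Termination

  mutual
    occs : ℕ → T → ℕ
    occs z (var x) with z ≟ x
    ... | yes _ = 1
    ... | no  _ = 0
    occs z (fn f ts) = occsVec z ts

    occsVec : ∀ {n} → ℕ → Vec T n → ℕ
    occsVec z []       = 0
    occsVec z (t ∷ ts) = occs z t + occsVec z ts

  lhsWeight : ℕ → T → ℕ
  lhsWeight z (var x)   = occs z (var x)
  lhsWeight z (fn f ts) = 2 * occsVec z ts

  -- A variable has total weight at most 1 iff it is absent or its only occurrence is as
  -- a left-hand side.  No action takes a variable out of this state.
  weight : ℕ → Eqn S → ℕ
  weight z (s , t) = lhsWeight z s + 2 * occs z t

  weights : List (Eqn S) → ℕ → ℕ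
  weights L z = sumOf (weight z) L

  lhsWeight≤ : ∀ z s → lhsWeight z s ≤ 2 * occs z s
  lhsWeight≤ z (var x)   = m≤m+n _ _
  lhsWeight≤ z (fn f ts) = ≤-refl

  occs≤lhsWeight : ∀ z s → occs z s ≤ lhsWeight z s
  occs≤lhsWeight z (var x)   = ≤-refl
  occs≤lhsWeight z (fn f ts) = m≤m+n _ _

  occs-self : ∀ x → occs x (var x) ≡ 1
  occs-self x with x ≟ x
  ... | yes _  = refl
  ... | no x≢x = contradiction refl x≢x

  occsVec-lookup : ∀ {n} z (ts : Vec T n) i → occs z (lookup ts i) ≤ occsVec z ts
  occsVec-lookup z (t ∷ ts) zero    = m≤m+n _ _
  occsVec-lookup z (t ∷ ts) (suc i) = ≤-trans (occsVec-lookup z ts i) (m≤n+m _ _)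

  Occ⇒occs : ∀ {x t} → Occ x t → 1 ≤ occs x t
  Occ⇒occs {x} here = ≤-reflexive (sym (occs-self x))
  Occ⇒occs {x} (inArg {f} {ts} i o) = ≤-trans (Occ⇒occs o) (occsVec-lookup x ts i)

  mutual
    ¬Occ⇒occs : ∀ x t → ¬ Occ x t → occs x t ≡ 0
    ¬Occ⇒occs x (var y) h with x ≟ y
    ... | yes refl = contradiction here h
    ... | no _     = refl
    ¬Occ⇒occs x (fn f ts) h = ¬Occ⇒occsVec x ts λ i → h ∘ inArg i

    ¬Occ⇒occsVec : ∀ {n} x (ts : Vec T n) → (∀ i → ¬ Occ x (lookup ts i)) → occsVec x ts ≡ 0
    ¬Occ⇒occsVec x []       h = refl
    ¬Occ⇒occsVec x (t ∷ ts) h = cong₂ _+_ (¬Occ⇒occs x t (h zero)) (¬Occ⇒occsVec x ts (h ∘ suc))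

  OccEq⇒weight : ∀ {x} d → OccEq S x d → 1 ≤ weight x d
  OccEq⇒weight {x} (s , t) (inj₁ o) = ≤-trans (Occ⇒occs o) (≤-trans (occs≤lhsWeight x s) (m≤m+n _ _))
  OccEq⇒weight {x} (s , t) (inj₂ o) = ≤-trans (Occ⇒occs o) (≤-trans (m≤m+n _ _) (m≤n+m _ (lhsWeight x s)))

  mutual
    occs-:=-≤ : ∀ z x t s → occs z t ≡ 0 → occs z (s [ x := t ]) ≤ occs z s
    occs-:=-≤ z x t (var y) eq with y ≟ x
    ... | yes _ = ≤-trans (≤-reflexive eq) z≤n
    ... | no  _ = ≤-refl
    occs-:=-≤ z x t (fn f ts) eq = occsVec-:=-≤ z x t ts eq

    occsVec-:=-≤ : ∀ {n} z x t (ts : Vec T n) → occs z t ≡ 0 → occsVec z (substVec S ts (x := t)) ≤ occsVec z ts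
    occsVec-:=-≤ z x t []       eq = z≤n
    occsVec-:=-≤ z x t (u ∷ us) eq = +-mono-≤ (occs-:=-≤ z x t u eq) (occsVec-:=-≤ z x t us eq)

  mutual
    occs-:=-0 : ∀ x t s → occs x t ≡ 0 → occs x (s [ x := t ]) ≡ 0
    occs-:=-0 x t (var y) eq with y ≟ x
    ... | yes _ = eq
    ... | no y≢x = ¬Occ⇒occs x (var y) λ { here → y≢x refl }
    occs-:=-0 x t (fn f ts) eq = occsVec-:=-0 x t ts eq

    occsVec-:=-0 : ∀ {n} x t (ts : Vec T n) → occs x t ≡ 0 → occsVec x (substVec S ts (x := t)) ≡ 0
    occsVec-:=-0 x t []       eq = refl
    occsVec-:=-0 x t (u ∷ us) eq = cong₂ _+_ (occs-:=-0 x t u eq) (occsVec-:=-0 x t us eq)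

  lhsWeight-0 : ∀ z s → occs z s ≡ 0 → lhsWeight z s ≡ 0
  lhsWeight-0 z s eq = n≤0⇒n≡0 (≤-trans (lhsWeight≤ z s) (≤-reflexive (cong (2 *_) eq)))

  weight-:=-≤ : ∀ z x t d → occs z t ≡ 0 → weight z (d [ x := t ]ₑ) ≤ weight z d
  weight-:=-≤ z x t (s , u) eq = +-mono-≤ (lhs s) (*-monoʳ-≤ 2 (occs-:=-≤ z x t u eq))
    where
    lhs : ∀ s → lhsWeight z (s [ x := t ]) ≤ lhsWeight z s
    lhs (var y) with y ≟ x
    ... | yes _ = ≤-trans (≤-reflexive (lhsWeight-0 z t eq)) z≤n
    ... | no  _ = ≤-refl
    lhs (fn f ts) = *-monoʳ-≤ 2 (occsVec-:=-≤ z x t ts eq)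

  weight-:=-0 : ∀ x t d → occs x t ≡ 0 → weight x (d [ x := t ]ₑ) ≡ 0
  weight-:=-0 x t (s , u) eq = cong₂ _+_ (lhsWeight-0 x (s [ x := t ]) (occs-:=-0 x t s eq)) (cong (2 *_) (occs-:=-0 x t u eq))

  -- Right-hand occurrences count twice, so a single one already exceeds 1.
  light⇒absent : ∀ {z s t L} → (s , t) ∈ L → weights L z ≤ 1 → occs z t ≡ 0
  light⇒absent {z} {s} {t} m le = twice (occs z t) (≤-trans (m≤n+m _ (lhsWeight z s)) (≤-trans (∈⇒≤sumOf (weight z) m) le))
    where
    twice : ∀ n → 2 * n ≤ 1 → n ≡ 0
    twice zero le = refl
    twice (suc n) le with ≤-trans (≤-reflexive (cong suc (sym (+-suc n (n + 0))))) le
    ... | s≤s ()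

  -- The cost of an equation

  rank : Eqn S → ℕ
  rank (fn _ _ , var _) = 2
  rank (var _ , fn _ _) = 1
  rank _                = 0

  -- `orient` and `merge` leave the size of the larger side unchanged; what falls is the rank, from
  -- 2 to 1 and from 1 to 0. `decompose` may raise the ranks, which the factor 3 compensates.
  cost : Eqn S → ℕ
  cost (s , t) = 3 * pot (size S s ⊔ size S t) + rank (s , t)

  rank≤2 : ∀ e → rank e ≤ 2
  rank≤2 (fn _ _ , var _)  = ≤-refl
  rank≤2 (var _ , fn _ _)  = s≤s z≤n
  rank≤2 (var _ , var _)   = z≤n
  rank≤2 (fn _ _ , fn _ _) = z≤n

  cost≤ : ∀ s t → cost (s , t) ≤ 5 * (pot (size S s) + pot (size S t))
  cost≤ s t = begin
    3 * p + rank (s , t) ≤⟨ +-monoʳ-≤ (3 * p) (rank≤2 (s , t)) ⟩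
    -- The 1 is `pot 1`, which is at most `p` because terms have positive size.
    3 * p + 2 * 1        ≤⟨ +-monoʳ-≤ (3 * p) (*-monoʳ-≤ 2 (pot-mono (≤-trans (size-pos s) (m≤m⊔n _ (size S t))))) ⟩
    3 * p + 2 * p        ≡⟨ *-distribʳ-+ p 3 2 ⟨
    5 * p                ≤⟨ *-monoʳ-≤ 5 (pot-⊔ (size S s) (size S t)) ⟩
    5 * (pot (size S s) + pot (size S t)) ∎
    where
    open ≤-Reasoning
    p : ℕ
    p = pot (size S s ⊔ size S t)

  cost-zip : ∀ {n} (ss ts : Vec T n) → sumOf cost (toList (zip ss ts)) ≤ 5 * (pot (sizeVec S ss) + pot (sizeVec S ts))
  cost-zip []       []       = z≤n
  cost-zip (s ∷ ss) (t ∷ ts) = begin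
    cost (s , t) + sumOf cost (toList (zip ss ts)) ≤⟨ +-mono-≤ (cost≤ s t) (cost-zip ss ts) ⟩
    5 * (a + b) + 5 * (c + d)                      ≡⟨ shuffle a b c d ⟩
    5 * ((a + c) + (b + d))                        ≤⟨ *-monoʳ-≤ 5 (+-mono-≤ (pot-+ (size S s) _) (pot-+ (size S t) _)) ⟩
    5 * (pot (size S s + sizeVec S ss) + pot (size S t + sizeVec S ts)) ∎
    where
    open ≤-Reasoning
    a b c d : ℕ
    a = pot (size S s)
    b = pot (size S t)
    c = pot (sizeVec S ss)
    d = pot (sizeVec S ts)
    shuffle : ∀ a b c d → 5 * (a + b) + 5 * (c + d) ≡ 5 * ((a + c) + (b + d))
    shuffle = solve-∀

  simplify-cost : ∀ {e N} → Simplify e N → sumOf cost N < cost e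
  simplify-cost (decompose f ss ts) = begin-strict
    sumOf cost (toList (zip ss ts)) ≤⟨ cost-zip ss ts ⟩
    5 * (pot m + pot n)             ≤⟨ *-monoʳ-≤ 5 (+-mono-≤ (pot-mono (m≤m⊔n m n)) (pot-mono (m≤n⊔m m n))) ⟩
    -- The arguments cost at most `10 * p` in all, the decomposed equation `12 * p + 3`; the summand
    -- `suc (2 * p + 2)` is the gap.
    5 * (p + p)                     <⟨ m<m+n _ (s≤s z≤n) ⟩
    5 * (p + p) + suc (2 * p + 2)   ≡⟨ lemma p ⟩
    3 * (4 * p + 1) + 0             ∎
    where
    open ≤-Reasoning
    m n p : ℕ
    m = sizeVec S ss
    n = sizeVec S ts
    p = pot (m ⊔ n)
    lemma : ∀ p → 5 * (p + p) + suc (2 * p + 2) ≡ 3 * (4 * p + 1) + 0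
    lemma = solve-∀
  simplify-cost (delete x) = s≤s z≤n
  simplify-cost (orient x f ts) = begin-strict
    3 * pot (1 ⊔ n) + 1 + 0 ≡⟨ +-identityʳ _ ⟩
    3 * pot (1 ⊔ n) + 1     <⟨ +-monoʳ-< (3 * pot (1 ⊔ n)) ≤-refl ⟩
    3 * pot (1 ⊔ n) + 2     ≡⟨ cong (λ k → 3 * pot k + 2) (⊔-comm 1 n) ⟩
    3 * pot (n ⊔ 1) + 2     ∎
    where
    open ≤-Reasoning
    n : ℕ
    n = size S (fn f ts)

  merge-cost : ∀ x f g (ss : Vec T (ar S f)) (ts : Vec T (ar S g)) → size S (fn f ss) ≤ size S (fn g ts) →
               sumOf cost ((fn f ss , fn g ts) ∷ []) < cost (var x , fn g ts)
  merge-cost x f g ss ts le = begin-strict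
    3 * pot (m ⊔ n) + 0 + 0 ≡⟨ trans (+-identityʳ _) (+-identityʳ _) ⟩
    3 * pot (m ⊔ n)         ≡⟨ cong (λ k → 3 * pot k) (trans (m≤n⇒m⊔n≡n le) (sym (m≤n⇒m⊔n≡n (size-pos (fn g ts))))) ⟩
    3 * pot (1 ⊔ n)         <⟨ m<m+n _ (s≤s z≤n) ⟩
    3 * pot (1 ⊔ n) + 1     ∎
    where
    open ≤-Reasoning
    m n : ℕ
    m = size S (fn f ss)
    n = size S (fn g ts)

  weights-zip : ∀ {n} z (ss ts : Vec T n) → weights (toList (zip ss ts)) z ≤ 2 * occsVec z ss + 2 * occsVec z ts
  weights-zip z []       []       = z≤n
  weights-zip z (s ∷ ss) (t ∷ ts) = ≤-trans
    (+-mono-≤ (+-monoˡ-≤ (2 * occs z t) (lhsWeight≤ z s)) (weights-zip z ss ts))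
    (≤-reflexive (shuffle (occs z s) (occs z t) (occsVec z ss) (occsVec z ts)))
    where
    shuffle : ∀ a b c d → (2 * a + 2 * b) + (2 * c + 2 * d) ≡ 2 * (a + c) + 2 * (b + d)
    shuffle = solve-∀

  -- No occurrence is created, and a bare variable that moves to a left-hand side counts less there
  -- than before.
  simplify-weight : ∀ {e N} z → Simplify e N → weights N z ≤ weight z e
  simplify-weight z (decompose f ss ts) = weights-zip z ss ts
  simplify-weight z (delete x) = z≤n
  simplify-weight z (orient x f ts) = begin
    a + 2 * b + 0           ≡⟨ +-identityʳ _ ⟩
    a + 2 * b               ≤⟨ +-monoˡ-≤ (2 * b) (m≤m+n a _) ⟩
    2 * a + 2 * b           ≡⟨ +-comm (2 * a) (2 * b) ⟩
    2 * b + 2 * a           ∎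
    where
    open ≤-Reasoning
    a b : ℕ
    a = occs z (var x)
    b = occsVec z ts

  -- `merge` copies the variables of `fn f ss`, so weights can grow in general. A variable of weight
  -- at most 1 is absent from this right-hand side, and only such variables have to be controlled.
  merge-weight : ∀ {L} z x f g (ss : Vec T (ar S f)) (ts : Vec T (ar S g)) → (var x , fn f ss) ∈ L → weights L z ≤ 1 →
                 weights ((fn f ss , fn g ts) ∷ []) z ≤ weight z (var x , fn g ts)
  merge-weight z x f g ss ts m le = begin
    2 * occsVec z ss + 2 * occsVec z ts + 0 ≡⟨ +-identityʳ _ ⟩
    2 * occsVec z ss + 2 * occsVec z ts     ≡⟨ cong (λ k → 2 * k + 2 * occsVec z ts) (light⇒absent m le) ⟩
    2 * occsVec z ts                        ≤⟨ m≤n+m _ (occs z (var x)) ⟩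
    occs z (var x) + 2 * occsVec z ts       ∎
    where open ≤-Reasoning

  -- The effect of a transition on a list containing the equations

  module _ {E E' L : List (Eqn S)} (E⊆L : ∀ {d} → d ∈ E → d ∈ L) where

    replace-bound : ∀ {e N} → Replace S E e N E' → (∀ z → weights L z ≤ 1 → weights N z ≤ weight z e) →
      sumOf cost N < cost e →
      ∃ λ L' → (∀ {d} → d ∈ E' → d ∈ L') × (∀ z → weights L z ≤ 1 → weights L' z ≤ 1) × sumOf cost L' < sumOf cost L
    replace-bound {e} {N} (e∈E , spec) wN cN = N ++ rest , incl , light , cheaper
      where
      open Split (split (E⊆L e∈E))
      incl : ∀ {d} → d ∈ E' → d ∈ N ++ rest
      incl {d} m with to (spec d) m
      ... | inj₁ (d∈E , d≢e) = ∈-++⁺ʳ N (∈-rest (E⊆L d∈E) d≢e)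
      ... | inj₂ d∈N         = ∈-++⁺ˡ d∈N
      light : ∀ z → weights L z ≤ 1 → weights (N ++ rest) z ≤ 1
      light z le = ≤-trans (≤-reflexive (sumOf-++ (weight z) N rest))
        (≤-trans (+-monoˡ-≤ _ (wN z le)) (≤-trans (≤-reflexive (sym (sum-rest (weight z)))) le))
      cheaper : sumOf cost (N ++ rest) < sumOf cost L
      cheaper rewrite sumOf-++ cost N rest | sum-rest cost = +-monoˡ-< _ cN

    -- Costs may grow here, but `x` becomes light: before, its own equation contributes 1 and the
    -- occurrence elsewhere at least 1 more; afterwards only the left-hand side of that equation
    -- remains. A light variable is absent from `t`, so the substitution does not copy it.
    eliminate-bound : ∀ {x t} → (var x , t) ∈ E → ¬ Occ x t → OccElsewhere S x (var x , t) E → ApplyElsewhere S E x t E' →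
      ∃ λ L' → (∀ {d} → d ∈ E' → d ∈ L') × (∀ z → weights L z ≤ 1 → weights L' z ≤ 1) × 2 ≤ weights L x × weights L' x ≤ 1
    eliminate-bound {x} {t} e∈E x∉t (d , d∈E , d≢e , xd) spec = (var x , t) ∷ map _[ x := t ]ₑ rest , incl , light , heavy , light-x
      where
      open Split (split (E⊆L e∈E))
      x∉t-occs : occs x t ≡ 0
      x∉t-occs = ¬Occ⇒occs x t x∉t
      incl : ∀ {d} → d ∈ E' → d ∈ (var x , t) ∷ map _[ x := t ]ₑ rest
      incl {d} m with to (spec d) m
      ... | inj₁ refl = here refl
      ... | inj₂ (d₀ , d₀∈E , d₀≢e , refl) = there (∈-map⁺ _[ x := t ]ₑ (∈-rest (E⊆L d₀∈E) d₀≢e))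
      light : ∀ z → weights L z ≤ 1 → weights ((var x , t) ∷ map _[ x := t ]ₑ rest) z ≤ 1
      light z le = ≤-trans
        (+-monoʳ-≤ (weight z (var x , t)) (sumOf-map-≤ (weight z) _[ x := t ]ₑ
          (λ d → weight-:=-≤ z x t d (light⇒absent (E⊆L e∈E) le)) rest))
        (≤-trans (≤-reflexive (sym (sum-rest (weight z)))) le)
      weight-e : weight x (var x , t) ≡ 1
      weight-e = cong₂ (λ a b → a + 2 * b) (occs-self x) x∉t-occs
      heavy : 2 ≤ weights L x
      heavy = ≤-trans (+-mono-≤ (≤-reflexive (sym weight-e))
                (≤-trans (OccEq⇒weight d xd) (∈⇒≤sumOf (weight x) (∈-rest (E⊆L d∈E) d≢e))))
              (≤-reflexive (sym (sum-rest (weight x))))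
      light-x : weights ((var x , t) ∷ map _[ x := t ]ₑ rest) x ≤ 1
      light-x = ≤-reflexive (cong₂ _+_ weight-e (sumOf-map-0 (weight x) _[ x := t ]ₑ (λ d → weight-:=-0 x t d x∉t-occs) rest))

  mutual
    var-bound : ∀ t → ∃ λ n → ∀ z → n ≤ z → occs z t ≡ 0
    var-bound (var x) = suc x , λ z x<z → ¬Occ⇒occs z (var x) λ { here → <-irrefl refl x<z }
    var-bound (fn f ts) = varVec-bound ts

    varVec-bound : ∀ {k} (ts : Vec T k) → ∃ λ n → ∀ z → n ≤ z → occsVec z ts ≡ 0
    varVec-bound [] = 0 , λ _ _ → refl
    varVec-bound (t ∷ ts) = let (m , p) = var-bound t ; (n , q) = varVec-bound ts in
      m ⊔ n , λ z le → cong₂ _+_ (p z (≤-trans (m≤m⊔n m n) le)) (q z (≤-trans (m≤n⊔m m n) le))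

  weights-bound : ∀ L → ∃ λ n → ∀ z → n ≤ z → weights L z ≡ 0
  weights-bound [] = 0 , λ _ _ → refl
  weights-bound ((s , t) ∷ L) = let (k , o) = var-bound s ; (m , p) = var-bound t ; (n , q) = weights-bound L in
    k ⊔ (m ⊔ n) , λ z le →
      let le' = ≤-trans (m≤n⊔m k (m ⊔ n)) le in
      cong₂ _+_ (cong₂ _+_ (lhsWeight-0 z s (o z (≤-trans (m≤m⊔n k _) le))) (cong (2 *_) (p z (≤-trans (m≤m⊔n m n) le'))))
                (q z (≤-trans (m≤n⊔m m n) le'))

  -- The list L only bounds E from above: equality of equations is undecidable, so the
  -- elements of E cannot be counted.
  bounded-acc : ∀ n u v {E} L → (∀ {d} → d ∈ E → d ∈ L) → (∀ z → n ≤ z → weights L z ≤ 1) →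
                countOver (weights L) n ≤ u → sumOf cost L < v → Acc (flip _⟶_) (ok E)
  bounded-acc n u (suc v) {E} L E⊆L fin unsolved costs = acc step
    where
    replaced : ∀ {E' e N} → Replace S E e N E' → (∀ z → weights L z ≤ 1 → weights N z ≤ weight z e) →
               sumOf cost N < cost e → Acc (flip _⟶_) (ok E')
    replaced r wN cN with replace-bound E⊆L r wN cN
    ... | L' , incl , light , cheaper = bounded-acc n u v L' incl (λ z → light z ∘ fin z)
      (≤-trans (countOver-mono (weights L) (weights L') light n) unsolved) (≤-trans cheaper (≤-pred costs))

    step : ∀ {c} → ok E ⟶ c → Acc (flip _⟶_) c
    step (simplify s r) = replaced r (λ z _ → simplify-weight z s) (simplify-cost s)
    step (merge x f g ss ts m ne le r) = replaced r (λ z → merge-weight z x f g ss ts (E⊆L m)) (merge-cost x f g ss ts le)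
    step (clash _ _ _ _ _ _) = acc λ ()
    step (eliminate x t m x∉t o a) with eliminate-bound E⊆L m x∉t o a
    ... | L' , incl , light , heavy , light-x = smaller u unsolved
      where
      x<n : x < n
      x<n = ≰⇒> λ n≤x → <-irrefl refl (≤-trans heavy (fin x n≤x))
      strict : countOver (weights L') n < countOver (weights L) n
      strict = countOver-strict (weights L) (weights L') light heavy light-x n x<n
      smaller : ∀ u → countOver (weights L) n ≤ u → Acc (flip _⟶_) (ok _)
      smaller zero    le = contradiction (≤-trans strict le) λ ()
      -- The count has dropped, so the bound on the costs may restart at whatever `L'` costs.
      smaller (suc u) le = bounded-acc n u (suc (sumOf cost L')) L' incl (λ z → light z ∘ fin z)
                             (≤-pred (≤-trans strict le)) ≤-refl

  ⟶-wellFounded : WellFounded (flip _⟶_)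
  ⟶-wellFounded fail = acc λ ()
  ⟶-wellFounded (ok E) = let (n , absent) = weights-bound E in
    bounded-acc n _ _ E id (λ z n≤z → ≤-trans (≤-reflexive (absent z n≤z)) z≤n) ≤-refl ≤-refl

  -- Halting of runs

  record Halt {L : Set} {Step : L → Config S → Config S → Set} {c₀} (r : Run Step c₀) : Set where
    field
      final    : Config S
      halts    : HaltsWith r final
      terminal : Terminal Step final
      reached  : Star _⟶_ c₀ final

  -- The translation of a step into `⟶` may use its position in the run, because the absence of
  -- action (6) is known only for the steps that the run performs. Well-foundedness then excludes an
  -- infinite run.
  run-halts : ∀ {L : Set} {Step : L → Config S → Config S → Set} {c₀} (r : Run Step c₀) →
    (∀ n c c' → conf r n ≡ just c → conf r (suc n) ≡ just c' → Step (lab r n) c c' → c ⟶ c') → Halt r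
  run-halts {Step = Step} {c₀} r sound = let (c , h , t , p) = from-index 0 c₀ (start r) (⟶-wellFounded c₀) in
    record { final = c ; halts = h ; terminal = t ; reached = p }
    where
    from-index : ∀ n c → conf r n ≡ just c → Acc (flip _⟶_) c →
                 ∃ λ c' → HaltsWith r c' × Terminal Step c' × Star _⟶_ c c'
    from-index n c eq (acc rs) with next r n c eq
    ... | inj₂ (eq' , term) = c , (n , eq , eq') , term , ε
    ... | inj₁ (c' , eq' , st) =
      let s = sound n c c' eq eq' st
          (d , h , t , p) = from-index (suc n) c' eq' (rs s)
      in d , h , t , s ◅ p

  -- Relations preserved by the transitions

  record Decomposable (R : T → T → Set) : Set where
    field
      R-refl  : ∀ {s} → R s s
      R-sym   : ∀ {s t} → R s t → R t s
      R-trans : ∀ {s t u} → R s t → R t u → R s u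
      R-cong  : ∀ {f} (ss ts : Vec T (ar S f)) → (∀ i → R (lookup ss i) (lookup ts i)) → R (fn f ss) (fn f ts)
      R-args  : ∀ {f} (ss ts : Vec T (ar S f)) → R (fn f ss) (fn f ts) → ∀ i → R (lookup ss i) (lookup ts i)
      R-clash : ∀ {f g} (ss : Vec T (ar S f)) (ts : Vec T (ar S g)) → f ≢ g → ¬ R (fn f ss) (fn g ts)

  Holds : (T → T → Set) → List (Eqn S) → Set
  Holds R E = ∀ s t → (s , t) ∈ E → R s t

  HoldsIn : (T → T → Set) → Config S → Set
  HoldsIn R (ok E) = Holds R E
  HoldsIn R fail   = ⊥

  module _ {R : T → T → Set} (dec : Decomposable R) where
    open Decomposable dec

    R-:= : ∀ {x t} → R (var x) t → ∀ s → R s (s [ x := t ])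
    R-:= {x} p (var y) with y ≟ x
    ... | yes refl = p
    ... | no  _    = R-refl
    R-:= {x} {t} p (fn f ts) = R-cong ts (substVec S ts (x := t)) (args ts)
      where
      args : ∀ {n} (us : Vec T n) i → R (lookup us i) (lookup (substVec S us (x := t)) i)
      args (u ∷ us) zero    = R-:= p u
      args (u ∷ us) (suc i) = args us i

    R-:=ₑ : ∀ {x t} → R (var x) t → ∀ s u → R s u → R (s [ x := t ]) (u [ x := t ])
    R-:=ₑ p s u q = R-trans (R-sym (R-:= p s)) (R-trans q (R-:= p u))

    R-:=ₑ⁻ : ∀ {x t} → R (var x) t → ∀ s u → R (s [ x := t ]) (u [ x := t ]) → R s u
    R-:=ₑ⁻ p s u q = R-trans (R-:= p s) (R-trans q (R-sym (R-:= p u)))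

    simplify-sound : ∀ {s t N} → Simplify (s , t) N → R s t → Holds R N
    simplify-sound (decompose f ss ts) p s t m with ∈-zip⁻ ss ts m
    ... | i , refl = R-args ss ts p i
    simplify-sound (orient x f ts) p s t (here refl) = R-sym p

    simplify-complete : ∀ {s t N} → Simplify (s , t) N → Holds R N → R s t
    simplify-complete (decompose f ss ts) h = R-cong ss ts λ i → h _ _ (∈-zip⁺ ss ts i)
    simplify-complete (delete x) h = R-refl
    simplify-complete (orient x f ts) h = R-sym (h _ _ (here refl))

    replace-sound : ∀ {E E' e N} → Replace S E e N E' → Holds R N → Holds R E → Holds R E'
    replace-sound (_ , spec) hN hE s t m with to (spec (s , t)) m
    ... | inj₁ (p , _) = hE s t p
    ... | inj₂ p       = hN s t p

    ⟶-sound : ∀ {c c'} → c ⟶ c' → HoldsIn R c → HoldsIn R c'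
    ⟶-sound (simplify s r) h = replace-sound r (simplify-sound s (h _ _ (proj₁ r))) h
    ⟶-sound (clash f g ss ts m f≢g) h = R-clash ss ts f≢g (h _ _ m)
    ⟶-sound (merge x f g ss ts m _ _ r) h = replace-sound r
      (λ { _ _ (here refl) → R-trans (R-sym (h _ _ m)) (h _ _ (proj₁ r)) }) h
    ⟶-sound (eliminate x t m _ _ spec) h s u p with to (spec (s , u)) p
    ... | inj₁ refl = h _ _ m
    ... | inj₂ ((s₀ , u₀) , q , _ , refl) = R-:=ₑ (h _ _ m) s₀ u₀ (h _ _ q)

    ⟶*-sound : ∀ {c c'} → Star _⟶_ c c' → HoldsIn R c → HoldsIn R c'
    ⟶*-sound ε        h = h
    ⟶*-sound (s ◅ ss) h = ⟶*-sound ss (⟶-sound s h)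

    module _ (stable : ∀ {s t} → ¬ ¬ R s t → R s t) where

      -- Stability of `R` permits the case distinction whether an equation of `E` is the replaced
      -- one, although equality of equations is not decidable.
      replace-complete : ∀ {E E' s t N} → Replace S E (s , t) N E' → (Holds R E' → R s t) → Holds R E' → Holds R E
      replace-complete {s = s} {t} (_ , spec) he hE' u v m = stable (¬¬-map decide ¬¬-excluded-middle)
        where
        decide : Dec ((u , v) ≡ (s , t)) → R u v
        decide (yes refl) = he hE'
        decide (no ne)    = hE' u v (from (spec (u , v)) (inj₁ (m , ne)))

      ⟶-complete : ∀ {c c'} → c ⟶ c' → HoldsIn R c' → HoldsIn R c
      ⟶-complete (simplify s r) =
        replace-complete r λ h → simplify-complete s λ u v m → h u v (from (proj₂ r (u , v)) (inj₂ m))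
      ⟶-complete (merge x f g ss ts m ne _ r) = replace-complete r λ h → R-trans
        (h _ _ (from (proj₂ r _) (inj₁ (m , λ { refl → ne refl }))))
        (h _ _ (from (proj₂ r _) (inj₂ (here refl))))
      ⟶-complete (eliminate x t m _ _ spec) h u v p = stable (¬¬-map decide ¬¬-excluded-middle)
        where
        x≈t : R (var x) t
        x≈t = h _ _ (from (spec _) (inj₁ refl))
        decide : Dec ((u , v) ≡ (var x , t)) → R u v
        decide (yes refl) = x≈t
        decide (no ne)    = R-:=ₑ⁻ x≈t u v (h _ _ (from (spec _) (inj₂ ((u , v) , p , ne , refl))))

      ⟶*-complete : ∀ {c c'} → Star _⟶_ c c' → HoldsIn R c' → HoldsIn R c
      ⟶*-complete ε        h = h
      ⟶*-complete (s ◅ ss) h = ⟶-complete s (⟶*-complete ss h)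

  -- Instances of decomposable relations

  ¬¬R : (T → T → Set) → T → T → Set
  ¬¬R R s t = ¬ ¬ R s t

  -- Supplies the stability that `⟶*-complete` asks for. Congruence survives because arities are
  -- finite, so that double negation commutes with quantification over the arguments.
  ¬¬-decomposable : ∀ {R} → Decomposable R → Decomposable (¬¬R R)
  ¬¬-decomposable dec = record
    { R-refl  = λ k → k R-refl
    ; R-sym   = ¬¬-map R-sym
    ; R-trans = λ p q → ¬¬-bind p λ p' → ¬¬-map (R-trans p') q
    ; R-cong  = λ ss ts ps → ¬¬-map (R-cong ss ts) (¬¬-∀Fin ps)
    ; R-args  = λ ss ts p i → ¬¬-map (λ p' → R-args ss ts p' i) p
    ; R-clash = λ ss ts f≢g p → p (R-clash ss ts f≢g)
    }
    where open Decomposable dec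

  -- `Holds (Identifies σ) E` is by definition `Unifier σ E`.
  Identifies : Subst S → T → T → Set
  Identifies σ s t = s [ σ ] ≡ t [ σ ]

  identifies-decomposable : ∀ σ → Decomposable (Identifies σ)
  identifies-decomposable σ = record
    { R-refl  = refl
    ; R-sym   = sym
    ; R-trans = trans
    ; R-cong  = λ {f} ss ts h → cong (fn f) (lookup-ext _ _ λ i →
                  trans (lookup-substVec ss σ i) (trans (h i) (sym (lookup-substVec ts σ i))))
    ; R-args  = λ ss ts eq i → trans (sym (lookup-substVec ss σ i))
                  (trans (cong (λ us → lookup us i) (fn-injective eq)) (lookup-substVec ts σ i))
    ; R-clash = λ ss ts f≢g eq → f≢g (fn-injectiveˡ eq)
    }

  resolve : Subst S → T → T
  resolve ρ (var x)   = ρ x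
  resolve ρ (fn f ts) = fn f ts

  mapArgs : (T → T) → T → T
  mapArgs h (var x)   = var x
  mapArgs h (fn f ts) = fn f (Vec.map h ts)

  -- The depth-k truncation of the possibly infinite tree obtained by unfolding ρ forever.
  unfold : Subst S → ℕ → T → T
  unfold ρ zero    s = var 0
  unfold ρ (suc k) s = mapArgs (unfold ρ k) (resolve ρ s)

  -- Equality of infinite trees, expressed by their finite truncations instead of coinductively. The
  -- placeholder at the cut is the same on both sides.
  SameTree : Subst S → T → T → Set
  SameTree ρ s t = ∀ k → unfold ρ k s ≡ unfold ρ k t

  sameTree-decomposable : ∀ ρ → Decomposable (SameTree ρ)
  sameTree-decomposable ρ = record
    { R-refl  = λ k → refl
    ; R-sym   = λ p k → sym (p k)
    ; R-trans = λ p q k → trans (p k) (q k)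
    ; R-cong  = λ { ss ts h zero → refl
                  ; {f} ss ts h (suc k) → cong (fn f) (lookup-ext _ _ λ i →
                      trans (lookup-map i (unfold ρ k) ss) (trans (h i k) (sym (lookup-map i (unfold ρ k) ts)))) }
    ; R-args  = λ ss ts p i k → trans (sym (lookup-map i (unfold ρ k) ss))
                  (trans (cong (λ us → lookup us i) (fn-injective (p (suc k)))) (lookup-map i (unfold ρ k) ts))
    -- Depth 1 already shows the root symbols.
    ; R-clash = λ ss ts f≢g p → f≢g (fn-injectiveˡ (p 1))
    }

  -- A truncation of positive depth depends on a term only through its resolved form.
  resolve⇒sameTree : ∀ ρ {s t} → resolve ρ s ≡ resolve ρ t → SameTree ρ s t
  resolve⇒sameTree ρ eq zero    = refl
  resolve⇒sameTree ρ eq (suc k) = cong (mapArgs (unfold ρ k)) eq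

  -- Terminal equation sets

  repr-lookup : ∀ E x → (var x , repr S E x) ∈ E ⊎ (repr S E x ≡ var x × (∀ t → ¬ (var x , t) ∈ E))
  repr-lookup [] x = inj₂ (refl , λ _ ())
  repr-lookup ((var y , t) ∷ E) x with x ≟ y
  ... | yes refl = inj₁ (here refl)
  ... | no x≢y with repr-lookup E x
  ...   | inj₁ m = inj₁ (there m)
  ...   | inj₂ (eq , none) = inj₂ (eq , λ { u (here refl) → x≢y refl ; u (there m) → none u m })
  repr-lookup ((fn f ts , t) ∷ E) x with repr-lookup E x
  ... | inj₁ m = inj₁ (there m)
  ... | inj₂ (eq , none) = inj₂ (eq , λ { u (there m) → none u m })

  -- Existence up to double negation is enough to contradict terminality.
  ¬¬-Replace : ∀ {E e} N → e ∈ E → ¬ ¬ (∃ λ E' → Replace S E e N E')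
  ¬¬-Replace {E} {e} N e∈E = ¬¬-map build (¬¬-filter (_≢ e) E)
    where
    build : (∃ λ E₀ → ∀ d → d ∈ E₀ ⇔ (d ∈ E × d ≢ e)) → ∃ λ E' → Replace S E e N E'
    build (E₀ , spec) = E₀ ++ N , e∈E , λ d → mk⇔
      (λ m → [ inj₁ ∘ to (spec d) , inj₂ ]′ (∈-++⁻ E₀ m))
      [ ∈-++⁺ˡ ∘ from (spec d) , ∈-++⁺ʳ E₀ ]′

  ¬¬-ApplyElsewhere : ∀ E x t → ¬ ¬ (∃ λ E' → ApplyElsewhere S E x t E')
  ¬¬-ApplyElsewhere E x t = ¬¬-map build (¬¬-filter (_≢ (var x , t)) E)
    where
    build : (∃ λ E₀ → ∀ d → d ∈ E₀ ⇔ (d ∈ E × d ≢ (var x , t))) → ∃ λ E' → ApplyElsewhere S E x t E'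
    build (E₀ , spec) = (var x , t) ∷ map _[ x := t ]ₑ E₀ , λ d → mk⇔
      (λ { (here refl) → inj₁ refl
         ; (there m) → let (d₀ , p , eq) = ∈-map⁻ _[ x := t ]ₑ m
                           (q , ne) = to (spec d₀) p in inj₂ (d₀ , q , ne , eq) })
      λ { (inj₁ refl) → here refl
        ; (inj₂ (d₀ , p , ne , refl)) → there (∈-map⁺ _[ x := t ]ₑ (from (spec d₀) (p , ne))) }

  Binding : List (Eqn S) → Set
  Binding E = ∀ e → e ∈ E → ∃₂ λ x t → e ≡ (var x , t) × t ≢ var x

  irreducible⇒binding : ∀ {E} → (∀ {e N E'} → Simplify e N → ¬ Replace S E e N E') →
    (∀ f g (ss : Vec T (ar S f)) (ts : Vec T (ar S g)) → (fn f ss , fn g ts) ∈ E → ¬ f ≢ g) → Binding E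
  irreducible⇒binding {E} irr nc (var x , t) m = x , t , refl , λ { refl → none (delete x) m }
    where
    none : ∀ {e N} → Simplify e N → ¬ e ∈ E
    none {N = N} s m = ¬¬-Replace N m λ (E' , r) → irr s r
  irreducible⇒binding {E} irr nc (fn f ss , var x) m = ⊥-elim (¬¬-Replace _ m λ (E' , r) → irr (orient x f ss) r)
  -- No decision between equal and distinct symbols is made: equal ones would allow a decomposition,
  -- so the symbols are distinct, which `nc` refutes.
  irreducible⇒binding {E} irr nc (fn f ss , fn g ts) m = ⊥-elim (nc f g ss ts m λ { refl →
    ¬¬-Replace _ m λ (E' , r) → irr (decompose f ss ts) r })

  MMA-binding : ∀ {E} → Terminal (MMA S) (ok E) → Binding E
  MMA-binding term = irreducible⇒binding
    (λ { (decompose f ss ts) r → term _ _ (act1 f ss ts r)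
       ; (delete x) r → term _ _ (act3 x r)
       ; (orient x f ts) r → term _ _ (act4 x f ts r) })
    λ f g ss ts m f≢g → term _ _ (act2 f g ss ts m f≢g)

  MMA⁻-binding : ∀ {E} → Terminal (MMA⁻ S) (ok E) → Binding E
  MMA⁻-binding term = irreducible⇒binding
    (λ { (decompose f ss ts) r → term _ _ (act1 f ss ts r)
       ; (delete x) r → term _ _ (act3 x r)
       ; (orient x f ts) r → term _ _ (act4 x f ts r) })
    λ f g ss ts m f≢g → term _ _ (act2 f g ss ts m f≢g)

  Eliminated : List (Eqn S) → Set
  Eliminated E = ∀ x t → (var x , t) ∈ E → ¬ Occ x t → ¬ OccElsewhere S x (var x , t) E

  MMA5-eliminated : ∀ {E} → (∀ c → ¬ MMA S a5 (ok E) c) → Eliminated E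
  MMA5-eliminated {E} term x t m x∉t o = ¬¬-ApplyElsewhere E x t λ (E' , spec) → term _ (act5 x t m x∉t o spec)

  -- Only uniqueness is weaker than in `SemiSolved`: terminality refutes `t ≢ u` but need not
  -- produce an equality.
  record WeaklySemiSolved (E : List (Eqn S)) : Set where
    field
      binding : Binding E
      unique  : ∀ x t u → (var x , t) ∈ E → (var x , u) ∈ E → ¬ t ≢ u
      alias   : ∀ x y → (var x , var y) ∈ E → ∀ d → d ∈ E → d ≢ (var x , var y) → ¬ OccEq S x d

  MMA⁻-weaklySemiSolved : ∀ {E} → Terminal (MMA⁻ S) (ok E) → WeaklySemiSolved E
  MMA⁻-weaklySemiSolved {E} term = record { binding = MMA⁻-binding term ; unique = unique ; alias = alias }
    where
    alias : ∀ x y → (var x , var y) ∈ E → ∀ d → d ∈ E → d ≢ (var x , var y) → ¬ OccEq S x d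
    alias x y m d d∈E d≢e o with MMA⁻-binding term _ m
    ... | _ , _ , refl , y≢x = ¬¬-ApplyElsewhere E x (var y) λ (E' , spec) →
      term _ _ (act5a x y m (λ { refl → y≢x refl }) (d , d∈E , d≢e , o) spec)

    merged : ∀ x f g (ss : Vec T (ar S f)) (ts : Vec T (ar S g)) → (var x , fn f ss) ∈ E → (var x , fn g ts) ∈ E →
             Term.fn f ss ≢ fn g ts → ¬ size S (fn f ss) ≤ size S (fn g ts)
    merged x f g ss ts m n ne le = ¬¬-Replace _ n λ (E' , r) → term _ _ (act5b x f g ss ts m n ne le r)

    unique : ∀ x t u → (var x , t) ∈ E → (var x , u) ∈ E → ¬ t ≢ u
    -- If one right-hand side is a variable, the other equation is an occurrence of `x` elsewhere.
    unique x (var y) u m n t≢u = alias x y m (var x , u) n (λ { refl → t≢u refl }) (inj₁ here)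
    unique x (fn f ss) (var y) m n t≢u = alias x y n (var x , fn f ss) m (λ ()) (inj₁ here)
    -- The size condition of action (5b) holds in one of the two orders.
    unique x (fn f ss) (fn g ts) m n t≢u with ≤-total (size S (fn f ss)) (size S (fn g ts))
    ... | inj₁ le = merged x f g ss ts m n t≢u le
    ... | inj₂ ge = merged x g f ts ss n m (t≢u ∘ sym) ge

  -- Two right-hand sides of the same variable have a common instance under the unifier, which turns
  -- doubly negated uniqueness into equality.
  unifiable⇒semiSolved : ∀ {E} → Unifiable S E → WeaklySemiSolved E → SemiSolved S E
  unifiable⇒semiSolved (σ , h) w = binding , (λ x t u m n →
    ≡-stable t u σ (trans (sym (h _ _ m)) (h _ _ n)) (unique x t u m n)) , alias
    where open WeaklySemiSolved w

  repr-¬¬ : ∀ {E x t} → (∀ x t u → (var x , t) ∈ E → (var x , u) ∈ E → ¬ t ≢ u) → (var x , t) ∈ E → ¬ ¬ (repr S E x ≡ t)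
  repr-¬¬ {E} {x} {t} unique m with repr-lookup E x
  ... | inj₁ n          = unique x _ t n m
  ... | inj₂ (_ , none) = contradiction m (none t)

  -- A binding x ≐ y leads to a variable y that is not itself bound to a variable, so two
  -- lookups reach the root of the tree of x.
  treeOf : List (Eqn S) → Subst S
  treeOf E x = resolve (repr S E) (repr S E x)

  -- A semi-solved set may be cyclic, like `X = f(X)`, and then has no unifier; infinite trees solve
  -- it all the same.
  semiSolved-sameTree : ∀ {E} → WeaklySemiSolved E → Holds (¬¬R (SameTree (treeOf E))) E
  semiSolved-sameTree {E} w s t m with WeaklySemiSolved.binding w _ m
  ... | x , t , refl , t≢x = ¬¬-map (λ eq → resolve⇒sameTree (treeOf E) {var x} {t} (roots t m t≢x eq)) (repr-¬¬ unique m)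
    where
    open WeaklySemiSolved w
    roots : ∀ t → (var x , t) ∈ E → t ≢ var x → repr S E x ≡ t → treeOf E x ≡ resolve (treeOf E) t
    roots (fn f ts) m t≢x eq = cong (resolve (repr S E)) eq
    roots (var y)   m t≢x eq = trans (cong (resolve (repr S E)) eq) root-y
      where
      root-y : repr S E y ≡ resolve (repr S E) (repr S E y)
      root-y with repr S E y in eq' | repr-lookup E y
      ... | fn f ts | _ = refl
      -- A variable binding of `y` would forbid the occurrence of `y` in the equation of `x`.
      ... | var z | inj₁ n = ⊥-elim (alias y z n (var x , var y) m (λ { refl → t≢x refl }) (inj₂ here))
      ... | var z | inj₂ (refl , _) = sym eq'

  -- No variable of a right-hand side is bound, since a bound one would have been eliminated there.
  -- Hence `repr S E` fixes every right-hand side.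
  solved-unifier : ∀ {E} → Binding E → (∀ x t → (var x , t) ∈ E → ¬ Occ x t) → Eliminated E →
                   Holds (¬¬R (Identifies (repr S E))) E
  solved-unifier {E} bind acyclic elim s t m with bind _ m
  ... | x , t , refl , _ = ¬¬-map (λ eq → trans eq (sym fixed)) (repr-¬¬ unique m)
    where
    unique : ∀ x t u → (var x , t) ∈ E → (var x , u) ∈ E → ¬ t ≢ u
    unique x t u m n t≢u = elim x t m (acyclic x t m) ((var x , u) , n , (λ { refl → t≢u refl }) , inj₁ here)
    fixed : t [ repr S E ] ≡ t
    fixed = subst-id t (repr S E) free
      where
      free : ∀ z → Occ z t → repr S E z ≡ var z
      free z o with repr-lookup E z
      ... | inj₂ (eq , _) = eq
      -- Were the equation of `x` the binding of `z` itself, `z` would occur in its own right-hand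
      -- side.
      ... | inj₁ n = ⊥-elim (elim z _ n (acyclic z _ n)
                       ((var x , t) , m , (λ e → acyclic z _ n (subst (Occ z) (cong proj₂ e) o)) , inj₂ o))

  -- Preservation of semi-solved forms

  SemiSolvedIn : Config S → Set
  SemiSolvedIn (ok E) = SemiSolved S E
  SemiSolvedIn fail   = ⊥

  -- The shape of the equations rules out `simplify` and `clash`, uniqueness rules out `merge`, and
  -- the clause on variable bindings rules out eliminating `x` by a variable. What remains is
  -- elimination by an application.
  semiSolved-⟶ : ∀ {c c'} → c ⟶ c' → SemiSolvedIn c → SemiSolvedIn c'
  semiSolved-⟶ (simplify (decompose _ _ _) r) (bind , _) with bind _ (proj₁ r)
  ... | _ , _ , () , _
  semiSolved-⟶ (simplify (delete x) r) (bind , _) with bind _ (proj₁ r)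
  ... | _ , _ , refl , ne = contradiction refl ne
  semiSolved-⟶ (simplify (orient _ _ _) r) (bind , _) with bind _ (proj₁ r)
  ... | _ , _ , () , _
  semiSolved-⟶ (clash _ _ _ _ m _) (bind , _) with bind _ m
  ... | _ , _ , () , _
  semiSolved-⟶ (merge x f g ss ts m ne _ r) (_ , unique , _) = contradiction (unique x _ _ m (proj₁ r)) ne
  semiSolved-⟶ (eliminate x (var y) m _ (d , d∈E , d≢e , o) _) (_ , _ , alias) = contradiction o (alias x y m d d∈E d≢e)
  semiSolved-⟶ (eliminate {E} {E'} x t@(fn f ts) m x∉t _ spec) (bind , unique , alias) = bind' , unique' , alias'
    where
    -- By uniqueness no other equation binds `x`, so the substitution changes right-hand sides only.
    Origin : Eqn S → Set
    Origin d = d ≡ (var x , t) ⊎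
      ∃₂ λ y u → (var y , u) ∈ E × y ≢ x × u ≢ var y × d ≡ (var y , u [ x := t ])

    origin : ∀ {d} → d ∈ E' → Origin d
    origin {d} p with to (spec d) p
    ... | inj₁ eq = inj₁ eq
    ... | inj₂ (d₀ , q , ne , refl) with bind d₀ q
    ...   | y , u , refl , u≢y = inj₂ (y , u , q , y≢x , u≢y , cong (_, u [ x := t ]) (:=-miss t y≢x))
      where
      y≢x : y ≢ x
      y≢x refl = ne (cong (var x ,_) (unique x u t q m))

    bind' : Binding E'
    bind' d p with origin p
    ... | inj₁ refl = x , t , refl , λ ()
    ... | inj₂ (y , u , q , y≢x , u≢y , refl) = y , u [ x := t ] , refl , fresh u u≢y
      where
      -- As `t` is an application, a term that is a variable after the substitution was the same
      -- variable before.
      fresh : ∀ u → u ≢ var y → u [ x := t ] ≢ var y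
      fresh (var z) u≢y eq with z ≟ x
      fresh (var z) u≢y () | yes _
      ... | no  _ = u≢y eq

    unique' : ∀ z u v → (var z , u) ∈ E' → (var z , v) ∈ E' → u ≡ v
    unique' z u v p q with origin p | origin q
    ... | inj₁ refl | inj₁ refl = refl
    ... | inj₁ refl | inj₂ (_ , _ , _ , y≢x , _ , refl) = contradiction refl y≢x
    ... | inj₂ (_ , _ , _ , y≢x , _ , refl) | inj₁ refl = contradiction refl y≢x
    ... | inj₂ (_ , _ , p' , _ , _ , refl) | inj₂ (_ , _ , q' , _ , _ , refl) = cong _[ x := t ] (unique _ _ _ p' q')

    alias' : ∀ y z → (var y , var z) ∈ E' → ∀ d → d ∈ E' → d ≢ (var y , var z) → ¬ OccEq S y d
    alias' y z p d d∈E' d≢e o with origin p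
    ... | inj₂ (_ , u , p' , y≢x , u≢y , eq) with old u eq
      where
      old : ∀ {w} u → (Term.var y , Term.var z) ≡ (var w , u [ x := t ]) → u ≡ var z × y ≡ w
      old (var v) eq with v ≟ x
      old (var v) ()   | yes _
      old (var v) refl | no  _ = refl , refl
    ...   | refl , refl with to (spec d) d∈E'
    ...     | inj₁ refl = alias y z p' d m (λ ()) o
    ...     | inj₂ ((s₀ , u₀) , q , ne , refl) = [ occ s₀ inj₁ , occ u₀ inj₂ ]′ o
      where
      d₀≢e : (s₀ , u₀) ≢ (var y , var z)
      d₀≢e refl = d≢e (sym (trans eq (cong (_, var z [ x := t ]) (sym (:=-miss t y≢x)))))
      -- An occurrence of `y` in the instance stems from the original equation or from `t`; `alias`
      -- for `E` excludes both.
      occ : ∀ s → (Occ y s → OccEq S y (s₀ , u₀)) → ¬ Occ y (s [ x := t ])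
      occ s side p with Occ-:= s p
      ... | inj₁ y∈s = alias y z p' (s₀ , u₀) q d₀≢e (side y∈s)
      ... | inj₂ y∈t = alias y z p' (var x , t) m (λ ()) (inj₂ y∈t)

  semiSolved-⟶* : ∀ {c c'} → Star _⟶_ c c' → SemiSolvedIn c → SemiSolvedIn c'
  semiSolved-⟶* ε        h = h
  semiSolved-⟶* (s ◅ ss) h = semiSolved-⟶* ss (semiSolved-⟶ s h)

  -- The unifier excludes a variable bound to a term containing it, so elimination applies to every
  -- binding and terminality leaves no occurrence of a bound variable elsewhere.
  semiSolved⇒solved : ∀ {E} → Unifiable S E → SemiSolved S E → Eliminated E → Solved S E
  semiSolved⇒solved {E} (σ , h) ss@(bind , _) elim = ss , λ x t y u m n o →
    let x∉t = acyclic x t m in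
    elim x t m x∉t ((var y , u) , n , (λ { refl → x∉t o }) , inj₂ o)
    where
    acyclic : ∀ x t → (var x , t) ∈ E → ¬ Occ x t
    acyclic x t m with bind _ m
    ... | _ , _ , refl , t≢x = occurs-check σ t≢x (h _ _ m)

  solved⇒acyclic : ∀ {E} → Solved S E → ∀ x t → (var x , t) ∈ E → ¬ Occ x t
  solved⇒acyclic (_ , free) x t m = free x t x t m m

  -- Outcomes of the runs

  MMA⁻-run-halts : ∀ {c₀} (r : Run (MMA⁻ S) c₀) → Halt r
  MMA⁻-run-halts r = run-halts r λ _ _ _ _ _ → MMA⁻⊆⟶

  MMA5-run-halts : ∀ {c₀} (r : Run (MMA5 S) c₀) → Halt r
  MMA5-run-halts r = run-halts r λ _ _ _ _ _ → MMA⊆⟶ λ ()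

  -- A solution of `E` in any decomposable relation excludes a clash, the only failure left without
  -- action (6). Nor can (6) apply to the final set, which is therefore acyclic and unified by its
  -- `repr`; the unifier is carried back along the run.
  No6-unifiable : ∀ {E R} → Σ (Run (MMA S) (ok E)) No6 → Decomposable R → Holds R E → ¬ ¬ Unifiable S E
  No6-unifiable {E} {R} (r , no6) dec hE = conclude final terminal reached
    where
    open Halt (run-halts r λ n c c' eq eq' → MMA⊆⟶ (no6 n c c' eq eq'))
    conclude : ∀ c → Terminal (MMA S) c → Star _⟶_ (ok E) c → ¬ ¬ Unifiable S E
    conclude fail term path = ⊥-elim (⟶*-sound dec path hE)
    conclude (ok E') term path = ¬¬-map (λ h → repr S E' , λ s t m → h (s , t) m) (¬¬-∀∈ E λ (s , t) → weak s t)
      where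
      bind : Binding E'
      bind = MMA-binding term
      acyclic : ∀ x t → (var x , t) ∈ E' → ¬ Occ x t
      acyclic x t m o with bind _ m
      ... | _ , _ , refl , t≢x = term _ _ (act6 x t m o (t≢x ∘ sym))
      weak : Holds (¬¬R (Identifies (repr S E'))) E
      weak = ⟶*-complete (¬¬-decomposable (identifies-decomposable _)) negated-stable path
        (solved-unifier bind acyclic (MMA5-eliminated λ c → term a5 c))

  -- Every unifier `τ` of `E` satisfies `τ x ≡ θ x [ τ ]`, so `τ` itself is the factor. That `θ`
  -- unifies `E` is first known up to double negation; the given unifier `σ` provides the common
  -- instances that remove it.
  repr-mgu : ∀ {E E'} → Star _⟶_ (ok E) (ok E') → Unifiable S E → Solved S E' → Eliminated E' → MGU S (repr S E') E
  repr-mgu {E} {E'} path (σ , hσ) solved elim = unifies , λ τ hτ → τ , factors τ hτ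
    where
    θ : Subst S
    θ = repr S E'
    factors : ∀ τ → Unifier S τ E → ∀ x → τ x ≡ θ x [ τ ]
    factors τ hτ x with repr-lookup E' x
    ... | inj₁ m        = ⟶*-sound (identifies-decomposable τ) path hτ _ _ m
    ... | inj₂ (eq , _) = cong _[ τ ] (sym eq)
    weak : Holds (¬¬R (Identifies θ)) E
    weak = ⟶*-complete (¬¬-decomposable (identifies-decomposable θ)) negated-stable path
      (solved-unifier (proj₁ (proj₁ solved)) (solved⇒acyclic solved) elim)
    unifies : Unifier S θ E
    unifies s t m = ≡-stable (s [ θ ]) (t [ θ ]) σ
      (trans (subst-absorb s θ σ (factors σ hσ)) (trans (hσ s t m) (sym (subst-absorb t θ σ (factors σ hσ)))))
      (weak s t m)

theorem11 : (S : Signature) (E : List (Eqn S)) →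
    Σ (Run (MMA S) (ok E)) No6 →
    (r : Run (MMA⁻ S) (ok E)) →
    (¬ Unifiable S E → HaltsWith r (fail)) ×
    (Unifiable S E →
    ∃ λ E' → HaltsWith r (ok E') × Unifiable S E' × SemiSolved S E' ×
    ((r₅ : Run (MMA5 S) (ok E')) →
    ∃ λ E'' → HaltsWith r₅ (ok E'') × Solved S E'' × MGU S (repr S E'') E))
theorem11 S E mma r = failing , succeeding
  where
  failing : ¬ Unifiable S E → HaltsWith r fail
  failing ¬uni with MMA⁻-run-halts S r
  ... | record { final = fail ; halts = h } = h
  ... | record { final = ok E' ; terminal = term ; reached = path } =
    -- The unfolded trees of `E'` satisfy `E'`, hence `E`, although `E` has no unifier.
    ⊥-elim (No6-unifiable S mma tree
      (⟶*-complete S tree negated-stable path (semiSolved-sameTree S (MMA⁻-weaklySemiSolved S term))) ¬uni)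
    where
    tree : Decomposable S (¬¬R S (SameTree S (treeOf S E')))
    tree = ¬¬-decomposable S (sameTree-decomposable S _)

  succeeding : Unifiable S E →
    ∃ λ E' → HaltsWith r (ok E') × Unifiable S E' × SemiSolved S E' ×
    ((r₅ : Run (MMA5 S) (ok E')) →
    ∃ λ E'' → HaltsWith r₅ (ok E'') × Solved S E'' × MGU S (repr S E'') E)
  succeeding (σ , hσ) with MMA⁻-run-halts S r
  ... | record { final = fail ; reached = path } = ⊥-elim (⟶*-sound S (identifies-decomposable S σ) path hσ)
  ... | record { final = ok E' ; halts = h ; terminal = term ; reached = path } =
    E' , h , uni' , semi' , solving
    where
    uni' : Unifiable S E'
    uni' = σ , ⟶*-sound S (identifies-decomposable S σ) path hσ
    semi' : SemiSolved S E'
    semi' = unifiable⇒semiSolved S uni' (MMA⁻-weaklySemiSolved S term)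
    solving : (r₅ : Run (MMA5 S) (ok E')) → ∃ λ E'' → HaltsWith r₅ (ok E'') × Solved S E'' × MGU S (repr S E'') E
    solving r₅ with MMA5-run-halts S r₅
    ... | record { final = fail ; reached = path₅ } = ⊥-elim (semiSolved-⟶* S path₅ semi')
    ... | record { final = ok E'' ; halts = h₅ ; terminal = term₅ ; reached = path₅ } =
      E'' , h₅ , solved , repr-mgu S (path ◅◅ path₅) (σ , hσ) solved elim
      where
      elim : Eliminated S E''
      elim = MMA5-eliminated S (term₅ _)
      solved : Solved S E''
      solved = semiSolved⇒solved S (σ , ⟶*-sound S (identifies-decomposable S σ) path₅ (proj₂ uni'))
        (semiSolved-⟶* S path₅ semi') elim
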